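{- For every stable allocation instance with rational data (quotas, capacities) and every given feasible rational allocation $x$, there is a finite sequence of better response steps starting from $x$ that leads to a stable allocation.
   Context: A stable allocation instance consists of a bipartite graph $G=(V,E)$ with color classes $J$ (jobs, the active side) and $M$ (machines, the passive side), quotas $q:V\to\mathbb{R}_{\ge 0}$, edge capacities $c:E\to\mathbb{R}_{\ge 0}$, and for every vertex $v$ a strict ranking $\mathrm{rank}_v$ of its incident edges ($v$ prefers $uv$ to $wv$ if $\mathrm{rank}_v(uv)<\mathrm{rank}_v(wv)$). An allocation is $x:E\to\mathbb{R}_{\ge0}$ with $x(e)\le c(e)$ for all $e$ and $x(v):=\sum_{e\in\delta(v)}x(e)\le q(v)$ for all $v$. An edge $jm$ ($j\in J$, $m\in M$) blocks $x$ if (1) $x(jm)<c(jm)$; (2) $x(j)<q(j)$ or $j$ prefers $jm$ to its worst edge with positive value in $x$; (3) $x(m)<q(m)$ or $m$ prefers $jm$ to its worst edge with positive value in $x$. An allocation is stable if no edge blocks it. A better response step: a job $j$ chooses an arbitrary blocking edge $jm$ and increases $x(jm)$; simultaneously $j$ and $m$ may decrease allocation only on edges that they rank worse than $jm$, such that the result is again a feasible allocation. -}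

module Defs where

open import Data.Nat using (ℕ; zero; suc) renaming (_<_ to _<ℕ_; _≤_ to _≤ℕ_)
open import Data.Fin using (Fin; zero; suc)
open import Data.Rational using (ℚ; 0ℚ; _+_; _≤_; _<_)
open import Data.Product using (Σ; _×_; _,_; ∃)
open import Data.Sum using (_⊎_)
open import Relation.Binary.PropositionalEquality using (_≡_; _≢_)
open import Relation.Nullary using (¬_)
open import Relation.Binary.Construct.Closure.ReflexiveTransitive using (Star)

∑ : (n : ℕ) → (Fin n → ℚ) → ℚ
∑ zero    f = 0ℚ
∑ (suc n) f = f zero + ∑ n (λ i → f (suc i))

record Instance : Set where
  field
    nJ nM nE : ℕ
    jobOf    : Fin nE → Fin nJ
    machOf   : Fin nE → Fin nM
    simple   : ∀ e f → jobOf e ≡ jobOf f → machOf e ≡ machOf f → e ≡ f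
    qJ       : Fin nJ → ℚ
    qM       : Fin nM → ℚ
    cap      : Fin nE → ℚ
    qJ≥0     : ∀ j → 0ℚ ≤ qJ j
    qM≥0     : ∀ m → 0ℚ ≤ qM m
    cap≥0    : ∀ e → 0ℚ ≤ cap e
    rankJ    : Fin nE → ℕ
    rankM    : Fin nE → ℕ
    rankJ-strict : ∀ e f → jobOf e ≡ jobOf f → rankJ e ≡ rankJ f → e ≡ f
    rankM-strict : ∀ e f → machOf e ≡ machOf f → rankM e ≡ rankM f → e ≡ f

module _ (I : Instance) where
  open Instance I

  Allocation : Set
  Allocation = Fin nE → ℚ

  loadJ : Allocation → Fin nJ → ℚ
  loadJ x j = ∑ nE (λ e → restrict e)
    where
      restrict : Fin nE → ℚ
      restrict e with Data.Fin._≟_ (jobOf e) j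
      ... | Relation.Nullary.yes _ = x e
      ... | Relation.Nullary.no  _ = 0ℚ

  loadM : Allocation → Fin nM → ℚ
  loadM x m = ∑ nE (λ e → restrict e)
    where
      restrict : Fin nE → ℚ
      restrict e with Data.Fin._≟_ (machOf e) m
      ... | Relation.Nullary.yes _ = x e
      ... | Relation.Nullary.no  _ = 0ℚ

  Feasible : Allocation → Set
  Feasible x = (∀ e → 0ℚ ≤ x e) × (∀ e → x e ≤ cap e)
             × (∀ j → loadJ x j ≤ qJ j) × (∀ m → loadM x m ≤ qM m)

  WorstPosJ : Allocation → Fin nJ → Fin nE → Set
  WorstPosJ x j w = jobOf w ≡ j × 0ℚ < x w
                  × (∀ f → jobOf f ≡ j → 0ℚ < x f → rankJ f ≤ℕ rankJ w)

  WorstPosM : Allocation → Fin nM → Fin nE → Set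
  WorstPosM x m w = machOf w ≡ m × 0ℚ < x w
                  × (∀ f → machOf f ≡ m → 0ℚ < x f → rankM f ≤ℕ rankM w)

  Blocking : Allocation → Fin nE → Set
  Blocking x e =
      x e < cap e
    × (loadJ x (jobOf e) < qJ (jobOf e)
        ⊎ ∃ λ w → WorstPosJ x (jobOf e) w × rankJ e <ℕ rankJ w)
    × (loadM x (machOf e) < qM (machOf e)
        ⊎ ∃ λ w → WorstPosM x (machOf e) w × rankM e <ℕ rankM w)

  Stable : Allocation → Set
  Stable x = Feasible x × (∀ e → ¬ Blocking x e)

  BetterResponse : Allocation → Allocation → Set
  BetterResponse x y = ∃ λ e →
      Blocking x e
    × x e < y e
    × (∀ f → f ≢ e →
         y f ≡ x f
         ⊎ (y f < x f
            × ((jobOf f ≡ jobOf e × rankJ e <ℕ rankJ f)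
               ⊎ (machOf f ≡ machOf e × rankM e <ℕ rankM f))))
    × Feasible y

  Steps : Allocation → Allocation → Set
  Steps = Star BetterResponse

{-# OPTIONS --safe #-}

-- All data are multiples of a common unit u, and every step raises one edge e by exactly u, lowering
-- at most one worse edge at each endpoint of e by u.
--
-- First, only keen edges are raised: blocking edges e whose job also holds a worse edge w. The job
-- moves one unit from w to e, so the sum of rankJ · x drops by at least u and this ends.
--
-- From then on every blocking edge belongs to a job with spare quota. Such a job raises its best
-- blocking edge; the machine uses spare quota if it has some and otherwise releases a unit of its
-- worst edge, so that it stays saturated. No keen edge reappears, because machines only improve, and
-- the sum of (rankM − R) · x, with R above all machine ranks, drops by at least u. Since x ≤ cap
-- this ends too, and it can only end in a stable allocation.

module Submission where

open import Defs
open import Data.Product using (_×_; ∃; _,_; proj₁; proj₂)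
open import Data.Nat as ℕ using (ℕ; zero; suc)
import Data.Nat.Properties as ℕₚ
open import Data.Nat.Coprimality using (1-coprimeTo) renaming (sym to coprime-sym)
open import Data.Nat.Induction using (<-wellFounded)
open import Data.Integer as ℤ using (ℤ) renaming (+_ to pos)
import Data.Integer.Properties as ℤₚ
open import Data.Rational hiding (pos)
open import Data.Rational.Properties
import Data.Rational.Unnormalised as ℚᵘ
import Data.Rational.Unnormalised.Properties as ℚᵘₚ
open import Data.Rational.Solver
open import Data.Fin using (Fin; zero; suc)
import Data.Fin as Fin
open import Data.Fin.Properties using (any?; suc-injective)
open import Data.Sum as Sum using (_⊎_; inj₁; inj₂)
open import Data.Maybe using (Maybe; just; nothing; maybe′)
import Data.Maybe.Properties as Maybeₚ
open import Data.Empty using (⊥-elim)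
open import Function using (_∘_)
open import Induction.WellFounded using (Acc; acc)
open import Relation.Nullary using (¬_; Dec; yes; no)
open import Relation.Nullary.Decidable using (_×-dec_; _⊎-dec_)
open import Relation.Unary using (Decidable)
open import Relation.Binary.PropositionalEquality hiding (J)
open import Relation.Binary.Construct.Closure.ReflexiveTransitive using (Star; ε; _◅_; _◅◅_)
open +-*-Solver using (solve; _:=_; _:+_; _:*_; :-_; _:-_; con)

-- Integers inside the rationals.

-- Abstract, because otherwise the ring solver computes with the gcds hidden in rational arithmetic.
abstract
  ι : ℤ → ℚ
  ι k = mkℚ k 0 (coprime-sym (1-coprimeTo ℤ.∣ k ∣))

  ι-homo-+ : ∀ k l → ι (k ℤ.+ l) ≡ ι k + ι l
  ι-homo-+ k l = toℚᵘ-injective (ℚᵘₚ.≃-trans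
    (ℚᵘ.*≡* (cong (ℤ._* pos 1) (sym (cong₂ ℤ._+_ (ℤₚ.*-identityʳ k) (ℤₚ.*-identityʳ l)))))
    (ℚᵘₚ.≃-sym (toℚᵘ-homo-+ (ι k) (ι l))))

  ι-homo-* : ∀ k l → ι (k ℤ.* l) ≡ ι k * ι l
  ι-homo-* k l = toℚᵘ-injective (ℚᵘₚ.≃-trans (ℚᵘ.*≡* refl) (ℚᵘₚ.≃-sym (toℚᵘ-homo-* (ι k) (ι l))))

  ι-homo-neg : ∀ k → ι (ℤ.- k) ≡ - ι k
  ι-homo-neg k = toℚᵘ-injective (ℚᵘₚ.≃-trans (ℚᵘ.*≡* refl) (ℚᵘₚ.≃-sym (toℚᵘ-homo‿- (ι k))))

  ι-mono-≤ : ∀ {k l} → k ℤ.≤ l → ι k ≤ ι l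
  ι-mono-≤ {k} {l} k≤l = *≤* (ℤₚ.*-monoʳ-≤-nonNeg (pos 1) k≤l)

  ι-cancel-< : ∀ {k l} → ι k < ι l → k ℤ.< l
  ι-cancel-< {k} {l} (*<* h) = ℤₚ.*-cancelʳ-<-nonNeg (pos 1) h

  ι-0 : ι (pos 0) ≡ 0ℚ
  ι-0 = refl

  ι-1 : ι (pos 1) ≡ 1ℚ
  ι-1 = refl

  numerator : ∀ q → q * ι (↧ q) ≡ ι (↥ q)
  numerator q@record{} = toℚᵘ-injective (ℚᵘₚ.≃-trans (toℚᵘ-homo-* q (ι (↧ q))) (ℚᵘ.*≡* (begin
    (↥ q ℤ.* ↧ q) ℤ.* pos 1 ≡⟨ ℤₚ.*-identityʳ _ ⟩
    ↥ q ℤ.* ↧ q           ≡⟨ cong (↥ q ℤ.*_) (sym (ℤₚ.*-identityʳ (↧ q))) ⟩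
    ↥ q ℤ.* (↧ q ℤ.* pos 1) ∎)))
    where open ≡-Reasoning

  ι-denominator⁻¹ : ∀ q → ∃ λ r → Positive r × ι (↧ q) * r ≡ 1ℚ
  ι-denominator⁻¹ q = 1/ ι (↧ q) , 1/pos⇒pos (ι (↧ q)) , *-inverseʳ (ι (↧ q))

ι-suc : ∀ k → ι (pos 1 ℤ.+ k) ≡ 1ℚ + ι k
ι-suc k = trans (ι-homo-+ (pos 1) k) (cong (_+ ι k) ι-1)

0≤ι : ∀ n → 0ℚ ≤ ι (pos n)
0≤ι n = subst (_≤ ι (pos n)) ι-0 (ι-mono-≤ (ℤ.+≤+ ℕ.z≤n))

-- Distinct integers differ by at least one. Applied to ranks, this is why exchanging an edge for a
-- better one lowers the potential by a full unit.
ι-mono-< : ∀ {k l} → k ℤ.< l → ι k ≤ - 1ℚ + ι l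
ι-mono-< {k} {l} k<l = subst (_≤ - 1ℚ + ι l)
  (trans (cong (- 1ℚ +_) (ι-suc k)) (solve 1 (λ a → :- con 1ℚ :+ (con 1ℚ :+ a) := a) refl (ι k)))
  (+-monoʳ-≤ (- 1ℚ) (ι-mono-≤ (ℤₚ.i<j⇒suc[i]≤j k<l)))

-- Integer multiples of a unit and the existence of common units.

infix 4 _∣ᵘ_
_∣ᵘ_ : ℚ → ℚ → Set
u ∣ᵘ q = ∃ λ k → q ≡ ι k * u

∣ᵘ-trans : ∀ {u v q} → u ∣ᵘ v → v ∣ᵘ q → u ∣ᵘ q
∣ᵘ-trans {u} (k , refl) (l , refl) = l ℤ.* k , (begin
  ι l * (ι k * u)  ≡⟨ *-assoc (ι l) (ι k) u ⟨
  ι l * ι k * u    ≡⟨ cong (_* u) (ι-homo-* l k) ⟨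
  ι (l ℤ.* k) * u  ∎)
  where open ≡-Reasoning

∣ᵘ-0 : ∀ {u} → u ∣ᵘ 0ℚ
∣ᵘ-0 {u} = pos 0 , sym (trans (cong (_* u) ι-0) (*-zeroˡ u))

∣ᵘ-ι* : ∀ {u q} k → u ∣ᵘ q → u ∣ᵘ ι k * q
∣ᵘ-ι* {u} k u∣q = ∣ᵘ-trans u∣q (k , refl)

∣ᵘ-+ : ∀ {u p q} → u ∣ᵘ p → u ∣ᵘ q → u ∣ᵘ p + q
∣ᵘ-+ {u} (k , refl) (l , refl) = k ℤ.+ l ,
  trans (sym (*-distribʳ-+ u (ι k) (ι l))) (cong (_* u) (sym (ι-homo-+ k l)))

∣ᵘ-neg : ∀ {u p} → u ∣ᵘ p → u ∣ᵘ - p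
∣ᵘ-neg {u} (k , refl) = ℤ.- k ,
  trans (neg-distribˡ-* (ι k) u) (cong (_* u) (sym (ι-homo-neg k)))

∣ᵘ-refl : ∀ {u} → u ∣ᵘ u
∣ᵘ-refl {u} = pos 1 , sym (trans (cong (_* u) ι-1) (*-identityˡ u))

-- Discreteness: the integer coefficients of `p` and `q` differ by at least one. Hence any slack in
-- a capacity or quota has room for a whole unit, and any positive value contains one.
∣ᵘ-gap : ∀ {u p q} → 0ℚ < u → u ∣ᵘ p → u ∣ᵘ q → p < q → p + u ≤ q
∣ᵘ-gap {u} 0<u (k , refl) (l , refl) p<q = begin
  ι k * u + u          ≡⟨ solve 2 (λ a b → a :* b :+ b := (con 1ℚ :+ a) :* b) refl (ι k) u ⟩
  (1ℚ + ι k) * u       ≡⟨ cong (_* u) (ι-suc k) ⟨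
  ι (pos 1 ℤ.+ k) * u    ≤⟨ *-monoʳ-≤-nonNeg u {{pos⇒nonNeg u}} (ι-mono-≤ (ℤₚ.i<j⇒suc[i]≤j k<l)) ⟩
  ι l * u              ∎
  where
  open ≤-Reasoning
  instance
    u-pos : Positive u
    u-pos = positive 0<u
  k<l : k ℤ.< l
  k<l = ι-cancel-< (*-cancelʳ-<-nonNeg u {{pos⇒nonNeg u}} p<q)

-- If `b` and `d` are the denominators, the unit is `1/(bd)`; each coefficient is one numerator
-- times the other denominator.
common-divisor : ∀ p q → 0ℚ < p → ∃ λ u → 0ℚ < u × u ∣ᵘ p × u ∣ᵘ q
common-divisor p q 0<p with ι-denominator⁻¹ p | ι-denominator⁻¹ q
... | b⁻¹ , b⁻¹-pos , bb⁻¹≡1 | d⁻¹ , d⁻¹-pos , dd⁻¹≡1 =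
  b⁻¹ * d⁻¹ , positive⁻¹ (b⁻¹ * d⁻¹) {{pos*pos⇒pos b⁻¹ {{b⁻¹-pos}} d⁻¹ {{d⁻¹-pos}}}} ,
  ( ↥ p ℤ.* ↧ q
  , scale p (ι (↧ p)) b⁻¹ (ι (↧ q)) d⁻¹ (b⁻¹ * d⁻¹) refl bb⁻¹≡1 dd⁻¹≡1 (numerator p) (ι-homo-* (↥ p) (↧ q))) ,
  ( ↥ q ℤ.* ↧ p
  , scale q (ι (↧ q)) d⁻¹ (ι (↧ p)) b⁻¹ (b⁻¹ * d⁻¹) (*-comm b⁻¹ d⁻¹) dd⁻¹≡1 bb⁻¹≡1 (numerator q) (ι-homo-* (↥ q) (↧ p)))
  where
  open ≡-Reasoning
  scale : ∀ p b b′ d d′ u {n m} → u ≡ b′ * d′ → b * b′ ≡ 1ℚ → d * d′ ≡ 1ℚ →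
          p * b ≡ n → m ≡ n * d → p ≡ m * u
  scale p b b′ d d′ u refl bb′≡1 dd′≡1 refl refl = begin
    p                             ≡⟨ trans (*-identityʳ (p * 1ℚ)) (*-identityʳ p) ⟨
    p * 1ℚ * 1ℚ                   ≡⟨ cong₂ (λ s t → p * s * t) bb′≡1 dd′≡1 ⟨
    p * (b * b′) * (d * d′)       ≡⟨ solve 5 (λ p b b′ d d′ → p :* (b :* b′) :* (d :* d′) := p :* b :* d :* (b′ :* d′)) refl
                                       p b b′ d d′ ⟩
    p * b * d * (b′ * d′)         ∎

-- The argument u₀ lets several families be given a common unit one after another.
refine-unit : ∀ {n} (f : Fin n → ℚ) u₀ → 0ℚ < u₀ → ∃ λ u → 0ℚ < u × u ∣ᵘ u₀ × ∀ i → u ∣ᵘ f i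
refine-unit {zero}  f u₀ 0<u₀ = u₀ , 0<u₀ , ∣ᵘ-refl , λ ()
refine-unit {suc n} f u₀ 0<u₀ with refine-unit (f ∘ suc) u₀ 0<u₀
... | u₁ , 0<u₁ , u₁∣u₀ , u₁∣f with common-divisor u₁ (f zero) 0<u₁
... | u , 0<u , u∣u₁ , u∣f0 = u , 0<u , ∣ᵘ-trans u∣u₁ u₁∣u₀ ,
  λ { zero → u∣f0 ; (suc i) → ∣ᵘ-trans u∣u₁ (u₁∣f i) }

archimedean : ∀ {u} → 0ℚ < u → ∀ {p} → u ∣ᵘ p → ∃ λ n → p ≤ ι (pos n) * u
archimedean {u} 0<u (k , refl) = ℤ.∣ k ∣ ,
  *-monoʳ-≤-nonNeg u {{pos⇒nonNeg u {{positive 0<u}}}} (ι-mono-≤ (k≤∣k∣ k))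
  where
  k≤∣k∣ : ∀ k → k ℤ.≤ pos ℤ.∣ k ∣
  k≤∣k∣ (pos n)      = ℤₚ.≤-refl
  k≤∣k∣ ℤ.-[1+ n ] = ℤ.-≤+

-- Finite sums, indicators and weighted sums.

∑-cong : ∀ n {f g : Fin n → ℚ} → (∀ i → f i ≡ g i) → ∑ n f ≡ ∑ n g
∑-cong zero    f≡g = refl
∑-cong (suc n) f≡g = cong₂ _+_ (f≡g zero) (∑-cong n (f≡g ∘ suc))

∑-mono : ∀ n {f g : Fin n → ℚ} → (∀ i → f i ≤ g i) → ∑ n f ≤ ∑ n g
∑-mono zero    f≤g = ≤-refl
∑-mono (suc n) f≤g = +-mono-≤ (f≤g zero) (∑-mono n (f≤g ∘ suc))

∑-0 : ∀ n → ∑ n (λ _ → 0ℚ) ≡ 0ℚ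
∑-0 zero    = refl
∑-0 (suc n) = trans (+-identityˡ _) (∑-0 n)

∑-+ : ∀ n (f g : Fin n → ℚ) → ∑ n (λ i → f i + g i) ≡ ∑ n f + ∑ n g
∑-+ zero    f g = refl
∑-+ (suc n) f g = trans (cong (λ s → (f zero + g zero) + s) (∑-+ n (f ∘ suc) (g ∘ suc)))
  (solve 4 (λ a b c d → (a :+ b) :+ (c :+ d) := (a :+ c) :+ (b :+ d)) refl
     (f zero) (g zero) (∑ n (f ∘ suc)) (∑ n (g ∘ suc)))

∑-* : ∀ n c (f : Fin n → ℚ) → ∑ n (λ i → c * f i) ≡ c * ∑ n f
∑-* zero    c f = sym (*-zeroʳ c)
∑-* (suc n) c f = trans (cong ((c * f zero) +_) (∑-* n c (f ∘ suc))) (sym (*-distribˡ-+ c _ _))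

∑-∣ᵘ : ∀ n {u} {f : Fin n → ℚ} → (∀ i → u ∣ᵘ f i) → u ∣ᵘ ∑ n f
∑-∣ᵘ zero    u∣f = ∣ᵘ-0
∑-∣ᵘ (suc n) u∣f = ∣ᵘ-+ (u∣f zero) (∑-∣ᵘ n (u∣f ∘ suc))

𝟙 : ∀ {a} {A : Set a} → Dec A → ℚ
𝟙 (yes _) = 1ℚ
𝟙 (no  _) = 0ℚ

𝟙-yes : ∀ {a} {A : Set a} (d : Dec A) → A → 𝟙 d ≡ 1ℚ
𝟙-yes (yes _) a = refl
𝟙-yes (no ¬a) a = ⊥-elim (¬a a)

𝟙-no : ∀ {a} {A : Set a} (d : Dec A) → ¬ A → 𝟙 d ≡ 0ℚ
𝟙-no (yes a) ¬a = ⊥-elim (¬a a)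
𝟙-no (no _)  ¬a = refl

𝟙-cong : ∀ {a b} {A : Set a} {B : Set b} (d : Dec A) (d′ : Dec B) → (A → B) → (B → A) → 𝟙 d ≡ 𝟙 d′
𝟙-cong (yes a) d′ to from = sym (𝟙-yes d′ (to a))
𝟙-cong (no ¬a) d′ to from = sym (𝟙-no d′ (¬a ∘ from))

0≤𝟙 : ∀ {a} {A : Set a} (d : Dec A) → 0ℚ ≤ 𝟙 d
0≤𝟙 (yes _) = nonNegative⁻¹ 1ℚ
0≤𝟙 (no  _) = ≤-refl

-- Vertex loads and both potentials are pairings of this kind, so one computation of the effect of a
-- step serves them all.
⟨_,_⟩ : ∀ {n} → (Fin n → ℚ) → (Fin n → ℚ) → ℚ
⟨_,_⟩ {n} W x = ∑ n (λ i → W i * x i)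

⟨,⟩-linear : ∀ {n} (W x z : Fin n → ℚ) u → ⟨ W , (λ i → x i + u * z i) ⟩ ≡ ⟨ W , x ⟩ + u * ⟨ W , z ⟩
⟨,⟩-linear {n} W x z u = begin
  ∑ n (λ i → W i * (x i + u * z i))
    ≡⟨ ∑-cong n (λ i → solve 4 (λ w x u z → w :* (x :+ u :* z) := w :* x :+ u :* (w :* z)) refl (W i) (x i) u (z i)) ⟩
  ∑ n (λ i → W i * x i + u * (W i * z i))
    ≡⟨ ∑-+ n _ _ ⟩
  ⟨ W , x ⟩ + ∑ n (λ i → u * (W i * z i))
    ≡⟨ cong (⟨ W , x ⟩ +_) (∑-* n u _) ⟩
  ⟨ W , x ⟩ + u * ⟨ W , z ⟩ ∎
  where open ≡-Reasoning

⟨,⟩-indicator : ∀ {n} (W : Fin n → ℚ) (e : Fin n) → ⟨ W , (λ f → 𝟙 (e Fin.≟ f)) ⟩ ≡ W e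
⟨,⟩-indicator {suc n} W zero = begin
  W zero * 1ℚ + ∑ n (λ i → W (suc i) * 0ℚ)
    ≡⟨ cong₂ _+_ (*-identityʳ (W zero)) (trans (∑-cong n (λ i → *-zeroʳ (W (suc i)))) (∑-0 n)) ⟩
  W zero + 0ℚ ≡⟨ +-identityʳ (W zero) ⟩
  W zero ∎
  where open ≡-Reasoning
⟨,⟩-indicator {suc n} W (suc e) = begin
  W zero * 0ℚ + ∑ n (λ i → W (suc i) * 𝟙 (suc e Fin.≟ suc i))
    ≡⟨ cong₂ _+_ (*-zeroʳ (W zero)) (∑-cong n (λ i → cong (W (suc i) *_)
         (𝟙-cong (suc e Fin.≟ suc i) (e Fin.≟ i) suc-injective (cong suc)))) ⟩
  0ℚ + ⟨ W ∘ suc , (λ f → 𝟙 (e Fin.≟ f)) ⟩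
    ≡⟨ +-identityˡ _ ⟩
  ⟨ W ∘ suc , (λ f → 𝟙 (e Fin.≟ f)) ⟩
    ≡⟨ ⟨,⟩-indicator (W ∘ suc) e ⟩
  W (suc e) ∎
  where open ≡-Reasoning

-- Elementary inequalities, extremal elements and descent.

0≤q-p : ∀ {p q} → p ≤ q → 0ℚ ≤ q - p
0≤q-p {p} {q} p≤q = subst (_≤ q - p) (+-inverseʳ p) (+-monoˡ-≤ (- p) p≤q)

p-q≤p : ∀ p {q} → 0ℚ ≤ q → p - q ≤ p
p-q≤p p {q} 0≤q = subst (p - q ≤_) (+-identityʳ p) (+-monoʳ-≤ p (neg-antimono-≤ 0≤q))

p-q<p : ∀ p {q} → 0ℚ < q → p - q < p
p-q<p p {q} 0<q = subst (p - q <_) (+-identityʳ p) (+-monoʳ-< p (neg-antimono-< 0<q))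

minimal : ∀ {n} {P : Fin n → Set} → Decidable P → (r : Fin n → ℕ) → ∃ P →
          ∃ λ e → P e × ∀ f → P f → r e ℕ.≤ r f
minimal {P = P} P? r (e , Pe) = go e Pe (<-wellFounded (r e))
  where
  go : ∀ e → P e → Acc ℕ._<_ (r e) → ∃ λ e → P e × ∀ f → P f → r e ℕ.≤ r f
  go e Pe (acc rec) with any? (λ f → P? f ×-dec (r f ℕ.<? r e))
  ... | yes (f , Pf , rf<re) = go f Pf (rec rf<re)
  ... | no  ¬smaller = e , Pe , λ f Pf → ℕₚ.≮⇒≥ (λ rf<re → ¬smaller (f , Pf , rf<re))

upper-bound : ∀ {n} (r : Fin n → ℕ) → ∃ λ R → ∀ e → r e ℕ.≤ R
upper-bound {zero}  r = 0 , λ ()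
upper-bound {suc n} r with upper-bound (r ∘ suc)
... | R , r≤R = r zero ℕ.+ R , λ { zero → ℕₚ.m≤m+n _ _ ; (suc e) → ℕₚ.≤-trans (r≤R e) (ℕₚ.m≤n+m _ _) }

maximal : ∀ {n} {P : Fin n → Set} → Decidable P → (r : Fin n → ℕ) → ∃ P →
          ∃ λ e → P e × ∀ f → P f → r f ℕ.≤ r e
maximal P? r ∃P with upper-bound r
-- Reversing the order by `R ∸ r` turns a minimum into a maximum; `r≤R` rules out truncation.
... | R , r≤R with minimal P? (λ e → R ℕ.∸ r e) ∃P
... | e , Pe , least = e , Pe , λ f Pf → ℕₚ.∸-cancelʳ-≤ (r≤R f) (least f Pf)

-- The initial potential is at most `n` units for some `n`; every step uses up at least one, and the
-- potential stays nonnegative. Recursion on `n` therefore terminates at a goal.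
descend : ∀ {A : Set} {_⟶_ : A → A → Set} {Inv Goal : A → Set} (φ : A → ℚ) {u} → 0ℚ < u →
          (∀ {a} → Inv a → u ∣ᵘ φ a) → (∀ {a} → Inv a → 0ℚ ≤ φ a) →
          (∀ {a} → Inv a → Goal a ⊎ ∃ λ b → a ⟶ b × Inv b × φ b + u ≤ φ a) →
          ∀ {a} → Inv a → ∃ λ b → Star _⟶_ a b × Inv b × Goal b
descend {A} {_⟶_} {Inv} {Goal} φ {u} 0<u u∣φ 0≤φ progress {a₀} inv₀ =
  let n , φ≤nu = archimedean 0<u (u∣φ inv₀) in go n inv₀ φ≤nu
  where
  open ≤-Reasoning
  cancel : ∀ {p q} → p + u ≤ q + u → p ≤ q
  cancel {p} {q} h = subst₂ _≤_ (shuffle p) (shuffle q) (+-monoˡ-≤ (- u) h)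
    where
    shuffle : ∀ p → p + u - u ≡ p
    shuffle p = solve 2 (λ p u → p :+ u :- u := p) refl p u
  go : ∀ n {a} → Inv a → φ a ≤ ι (pos n) * u → ∃ λ b → Star _⟶_ a b × Inv b × Goal b
  go n {a} inv φa≤nu with progress inv
  ... | inj₁ goal = a , ε , inv , goal
  -- No units are left, so a further drop by `u` would make the potential negative.
  go zero {a} inv φa≤nu | inj₂ (b , a⟶b , inv′ , φb+u≤φa) = ⊥-elim (<-irrefl refl (begin-strict
    0ℚ             ≡⟨ +-identityˡ 0ℚ ⟨
    0ℚ + 0ℚ        <⟨ +-mono-≤-< (0≤φ inv′) 0<u ⟩
    φ b + u        ≤⟨ φb+u≤φa ⟩
    φ a            ≤⟨ φa≤nu ⟩
    ι (pos 0) * u  ≡⟨ trans (cong (_* u) ι-0) (*-zeroˡ u) ⟩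
    0ℚ             ∎))
  go (suc n) {a} inv φa≤nu | inj₂ (b , a⟶b , inv′ , φb+u≤φa) =
    let c , b⟶*c , inv″ , goal = go n inv′ (cancel (begin
          φ b + u                  ≤⟨ φb+u≤φa ⟩
          φ a                      ≤⟨ φa≤nu ⟩
          ι (pos (suc n)) * u      ≡⟨ cong (_* u) (ι-suc (pos n)) ⟩
          (1ℚ + ι (pos n)) * u     ≡⟨ solve 2 (λ k u → (con 1ℚ :+ k) :* u := k :* u :+ u) refl (ι (pos n)) u ⟩
          ι (pos n) * u + u        ∎))
    in c , a⟶b ◅ b⟶*c , inv″ , goal

-- Shifting one unit between edges.

_≟ᴹ_ : ∀ {n} (o o′ : Maybe (Fin n)) → Dec (o ≡ o′)
_≟ᴹ_ = Maybeₚ.≡-dec Fin._≟_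

module _ {n : ℕ} where

  weight : (Fin n → ℚ) → Maybe (Fin n) → ℚ
  weight W = maybe′ W 0ℚ

  move : (Fin n → ℚ) → Maybe (Fin n) → ℚ → Fin n → ℚ
  move x o c f = x f + c * 𝟙 (o ≟ᴹ just f)

  move-hit : ∀ x {o} c {f} → o ≡ just f → move x o c f ≡ x f + c
  move-hit x {o} c {f} h = cong (x f +_) (trans (cong (c *_) (𝟙-yes (o ≟ᴹ just f) h)) (*-identityʳ c))

  move-miss : ∀ x {o} c {f} → o ≢ just f → move x o c f ≡ x f
  move-miss x {o} c {f} h = trans
    (cong (x f +_) (trans (cong (c *_) (𝟙-no (o ≟ᴹ just f) h)) (*-zeroʳ c))) (+-identityʳ (x f))

  ⟨,⟩-move : ∀ W x o c → ⟨ W , move x o c ⟩ ≡ ⟨ W , x ⟩ + c * weight W o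
  ⟨,⟩-move W x o c = trans (⟨,⟩-linear W x _ c) (cong (λ s → ⟨ W , x ⟩ + c * s) (indicator o))
    where
    indicator : ∀ o → ⟨ W , (λ f → 𝟙 (o ≟ᴹ just f)) ⟩ ≡ weight W o
    indicator nothing  = trans (∑-cong n (λ f → *-zeroʳ (W f))) (∑-0 n)
    indicator (just e) = trans
      (∑-cong n (λ f → cong (W f *_) (𝟙-cong (just e ≟ᴹ just f) (e Fin.≟ f) Maybeₚ.just-injective (cong just))))
      (⟨,⟩-indicator W e)

  ∣ᵘ-move : ∀ {u x} → (∀ f → u ∣ᵘ x f) → ∀ o {c} → u ∣ᵘ c → ∀ f → u ∣ᵘ move x o c f
  ∣ᵘ-move {u} {x} u∣x o {c} u∣c f with o ≟ᴹ just f
  ... | yes h = subst (u ∣ᵘ_) (sym (cong (x f +_) (*-identityʳ c))) (∣ᵘ-+ (u∣x f) u∣c)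
  ... | no  h = subst (u ∣ᵘ_) (sym (trans (cong (x f +_) (*-zeroʳ c)) (+-identityʳ (x f)))) (u∣x f)

  -- The edge `e` gains a unit, and `o` and `o′` are the edges released at its two endpoints. The
  -- value `nothing` stands for an endpoint that uses spare quota instead.
  shift : ℚ → (Fin n → ℚ) → Fin n → Maybe (Fin n) → Maybe (Fin n) → Fin n → ℚ
  shift u x e o o′ = move (move (move x (just e) u) o (- u)) o′ (- u)

  ⟨,⟩-shift : ∀ W u x e o o′ →
              ⟨ W , shift u x e o o′ ⟩ ≡ ⟨ W , x ⟩ + u * (W e - weight W o - weight W o′)
  ⟨,⟩-shift W u x e o o′ = begin
    ⟨ W , shift u x e o o′ ⟩
      ≡⟨ ⟨,⟩-move W _ o′ (- u) ⟩
    ⟨ W , move (move x (just e) u) o (- u) ⟩ + - u * weight W o′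
      ≡⟨ cong (_+ - u * weight W o′) (⟨,⟩-move W _ o (- u)) ⟩
    ⟨ W , move x (just e) u ⟩ + - u * weight W o + - u * weight W o′
      ≡⟨ cong (λ s → s + - u * weight W o + - u * weight W o′) (⟨,⟩-move W x (just e) u) ⟩
    ⟨ W , x ⟩ + u * W e + - u * weight W o + - u * weight W o′
      ≡⟨ solve 5 (λ s u a b c → s :+ u :* a :+ (:- u) :* b :+ (:- u) :* c := s :+ u :* (a :- b :- c)) refl
           ⟨ W , x ⟩ u (W e) (weight W o) (weight W o′) ⟩
    ⟨ W , x ⟩ + u * (W e - weight W o - weight W o′) ∎
    where open ≡-Reasoning

  -- Pairings are linear, so the order of the releases is irrelevant. This lets bounds that charge
  -- the gain of `e` to the first release be used for the machine's release too.
  ⟨,⟩-shift-comm : ∀ W u x e o o′ → ⟨ W , shift u x e o o′ ⟩ ≡ ⟨ W , shift u x e o′ o ⟩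
  ⟨,⟩-shift-comm W u x e o o′ = begin
    ⟨ W , shift u x e o o′ ⟩
      ≡⟨ ⟨,⟩-shift W u x e o o′ ⟩
    ⟨ W , x ⟩ + u * (W e - weight W o - weight W o′)
      ≡⟨ solve 5 (λ s u a b c → s :+ u :* (a :- b :- c) := s :+ u :* (a :- c :- b)) refl
           ⟨ W , x ⟩ u (W e) (weight W o) (weight W o′) ⟩
    ⟨ W , x ⟩ + u * (W e - weight W o′ - weight W o)
      ≡⟨ ⟨,⟩-shift W u x e o′ o ⟨
    ⟨ W , shift u x e o′ o ⟩ ∎
    where open ≡-Reasoning

  -- The number `d` bounds the gain at `e` net of the first release; the second can only lower the
  -- sum. Loads use `d` equal to 0 or 1, potentials use -1.
  ⟨,⟩-shift-≤ : ∀ W {u} x e o o′ d → 0ℚ < u → W e ≤ d + weight W o → 0ℚ ≤ weight W o′ →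
                ⟨ W , shift u x e o o′ ⟩ ≤ ⟨ W , x ⟩ + u * d
  ⟨,⟩-shift-≤ W {u} x e o o′ d 0<u a≤d+b 0≤c = begin
    ⟨ W , shift u x e o o′ ⟩
      ≡⟨ ⟨,⟩-shift W u x e o o′ ⟩
    ⟨ W , x ⟩ + u * (W e - b - c)
      ≤⟨ +-monoʳ-≤ ⟨ W , x ⟩ (*-monoˡ-≤-nonNeg u {{pos⇒nonNeg u {{positive 0<u}}}} (begin
           W e - b - c    ≤⟨ p-q≤p (W e - b) 0≤c ⟩
           W e - b        ≤⟨ +-monoˡ-≤ (- b) a≤d+b ⟩
           d + b - b      ≡⟨ solve 2 (λ d b → d :+ b :- b := d) refl d b ⟩
           d              ∎)) ⟩
    ⟨ W , x ⟩ + u * d ∎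
    where
    open ≤-Reasoning
    b = weight W o
    c = weight W o′

  module Shift (u : ℚ) (x : Fin n → ℚ) (e : Fin n) (o o′ : Maybe (Fin n)) where

    private
      x₁ x₂ : Fin n → ℚ
      x₁ = move x (just e) u
      x₂ = move x₁ o (- u)

    at-e : o ≢ just e → o′ ≢ just e → shift u x e o o′ e ≡ x e + u
    at-e o≢e o′≢e = trans (move-miss x₂ (- u) o′≢e) (trans (move-miss x₁ (- u) o≢e) (move-hit x u refl))

    module _ {f : Fin n} (f≢e : f ≢ e) where

      private
        x₁≡x : x₁ f ≡ x f
        x₁≡x = move-miss x u (≢-sym f≢e ∘ Maybeₚ.just-injective)

      unchanged : o ≢ just f → o′ ≢ just f → shift u x e o o′ f ≡ x f
      unchanged o≢f o′≢f = trans (move-miss x₂ (- u) o′≢f) (trans (move-miss x₁ (- u) o≢f) x₁≡x)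

      reduced : (o ≡ just f → o′ ≢ just f) → o ≡ just f ⊎ o′ ≡ just f → shift u x e o o′ f ≡ x f - u
      reduced disjoint (inj₁ o≡f) = trans (move-miss x₂ (- u) (disjoint o≡f))
        (trans (move-hit x₁ (- u) o≡f) (cong (_- u) x₁≡x))
      reduced disjoint (inj₂ o′≡f) = trans (move-hit x₂ (- u) o′≡f)
        (cong (_- u) (trans (move-miss x₁ (- u) (λ o≡f → disjoint o≡f o′≡f)) x₁≡x))

      change : (o ≡ just f → o′ ≢ just f) →
               shift u x e o o′ f ≡ x f ⊎ (shift u x e o o′ f ≡ x f - u × (o ≡ just f ⊎ o′ ≡ just f))
      change disjoint = cases (o ≟ᴹ just f) (o′ ≟ᴹ just f)
        where
        cases : Dec (o ≡ just f) → Dec (o′ ≡ just f) →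
                shift u x e o o′ f ≡ x f ⊎ (shift u x e o o′ f ≡ x f - u × (o ≡ just f ⊎ o′ ≡ just f))
        cases (yes o≡f) _          = inj₂ (reduced disjoint (inj₁ o≡f) , inj₁ o≡f)
        cases (no _)    (yes o′≡f) = inj₂ (reduced disjoint (inj₂ o′≡f) , inj₂ o′≡f)
        cases (no o≢f)  (no o′≢f)  = inj₁ (unchanged o≢f o′≢f)

-- One side of the bipartite graph, treated once for jobs and machines.

record Side (n : ℕ) : Set where
  field
    {size} : ℕ
    at     : Fin n → Fin size
    rank   : Fin n → ℕ
    quota  : Fin size → ℚ

open Side

module _ {n : ℕ} (S : Side n) where

  χ : Fin (size S) → Fin n → ℚ
  χ i e = 𝟙 (at S e Fin.≟ i)

  load : (Fin n → ℚ) → Fin (size S) → ℚ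
  load x i = ⟨ χ i , x ⟩

  ∣ᵘ-load : ∀ {u x} → (∀ e → u ∣ᵘ x e) → ∀ i → u ∣ᵘ load x i
  ∣ᵘ-load {u} {x} u∣x i = ∑-∣ᵘ n (λ e → scaled (at S e Fin.≟ i) (u∣x e))
    where
    scaled : ∀ {A : Set} (d : Dec A) {q} → u ∣ᵘ q → u ∣ᵘ 𝟙 d * q
    scaled (yes _) {q} u∣q = subst (u ∣ᵘ_) (sym (*-identityˡ q)) u∣q
    scaled (no _)  {q} u∣q = subst (u ∣ᵘ_) (sym (*-zeroˡ q)) ∣ᵘ-0

  Spare : (Fin n → ℚ) → Fin n → Set
  Spare x e = load x (at S e) < quota S (at S e)

  -- Any worse positive edge may serve, not just the worst one; by `below⇒worst` this yields the
  -- same notion of willingness.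
  Below : (Fin n → ℚ) → Fin n → Fin n → Set
  Below x e w = at S w ≡ at S e × rank S e ℕ.< rank S w × 0ℚ < x w

  Willing : (Fin n → ℚ) → Fin n → Set
  Willing x e = Spare x e ⊎ ∃ (Below x e)

  Release : (Fin n → ℚ) → Fin n → Maybe (Fin n) → Set
  Release x e nothing  = Spare x e
  Release x e (just w) = Below x e w

  Worst : (Fin n → ℚ) → Fin (size S) → Fin n → Set
  Worst x i w = at S w ≡ i × 0ℚ < x w × (∀ f → at S f ≡ i → 0ℚ < x f → rank S f ℕ.≤ rank S w)

  below? : ∀ x e → Dec (∃ (Below x e))
  below? x e = any? (λ w → (at S w Fin.≟ at S e) ×-dec (rank S e ℕ.<? rank S w) ×-dec (0ℚ <? x w))

  willing? : ∀ x e → Dec (Willing x e)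
  willing? x e = (load x (at S e) <? quota S (at S e)) ⊎-dec below? x e

  willing⇒release : ∀ {x e} → Willing x e → ∃ (Release x e)
  willing⇒release (inj₁ spare)       = nothing , spare
  willing⇒release (inj₂ (w , below)) = just w , below

  release⇒willing : ∀ {x e} o → Release x e o → Willing x e
  release⇒willing nothing  spare = inj₁ spare
  release⇒willing (just w) below = inj₂ (w , below)

  -- A worst positive edge exists because `v` is positive, and it ranks at least as badly as `v`,
  -- hence worse than `e`.
  below⇒worst : ∀ {x e} → ∃ (Below x e) → ∃ λ w → Worst x (at S e) w × rank S e ℕ.< rank S w
  below⇒worst {x} {e} (v , atv , e<v , 0<xv)
    with maximal (λ w → (at S w Fin.≟ at S e) ×-dec (0ℚ <? x w)) (rank S) (v , atv , 0<xv)
  ... | w , (atw , 0<xw) , greatest =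
    w , (atw , 0<xw , λ f atf 0<xf → greatest f (atf , 0<xf)) , ℕₚ.<-≤-trans e<v (greatest v (atv , 0<xv))

  release-≢ : ∀ {x e} o → Release x e o → o ≢ just e
  release-≢ (just w) (_ , e<w , _) refl = ℕₚ.<-irrefl refl e<w

  -- At the endpoint of `e`, either spare quota has room for a whole unit by `∣ᵘ-gap`, or the
  -- released edge lies at the same vertex and cancels the gain. At every other vertex the load
  -- cannot grow.
  load-shift-≤ : ∀ {u x e} → 0ℚ < u → (∀ f → u ∣ᵘ x f) → (∀ i → u ∣ᵘ quota S i) →
                 (∀ i → load x i ≤ quota S i) → ∀ o o′ → Release x e o →
                 ∀ i → load (shift u x e o o′) i ≤ quota S i
  load-shift-≤ {u} {x} {e} 0<u u∣x u∣q load≤q o o′ rel i = bound o rel (at S e Fin.≟ i)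
    where
    open ≤-Reasoning
    0≤weight : ∀ o → 0ℚ ≤ weight (χ i) o
    0≤weight nothing  = ≤-refl
    0≤weight (just f) = 0≤𝟙 (at S f Fin.≟ i)

    no-gain : ∀ o → χ i e ≤ 0ℚ + weight (χ i) o → load (shift u x e o o′) i ≤ quota S i
    no-gain o h = begin
      load (shift u x e o o′) i ≤⟨ ⟨,⟩-shift-≤ (χ i) x e o o′ 0ℚ 0<u h (0≤weight o′) ⟩
      load x i + u * 0ℚ         ≡⟨ trans (cong (load x i +_) (*-zeroʳ u)) (+-identityʳ _) ⟩
      load x i                  ≤⟨ load≤q i ⟩
      quota S i                 ∎

    bound : ∀ o → Release x e o → Dec (at S e ≡ i) → load (shift u x e o o′) i ≤ quota S i
    bound nothing spare (yes refl) = begin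
      load (shift u x e nothing o′) i
        ≤⟨ ⟨,⟩-shift-≤ (χ i) x e nothing o′ 1ℚ 0<u (≤-reflexive (𝟙-yes (at S e Fin.≟ i) refl)) (0≤weight o′) ⟩
      load x i + u * 1ℚ ≡⟨ cong (load x i +_) (*-identityʳ u) ⟩
      load x i + u      ≤⟨ ∣ᵘ-gap 0<u (∣ᵘ-load u∣x i) (u∣q i) spare ⟩
      quota S i         ∎
    bound nothing  _ (no e∉i) = no-gain nothing (≤-reflexive (𝟙-no (at S e Fin.≟ i) e∉i))
    bound (just w) (atw , _) _ = no-gain (just w)
      (≤-reflexive (trans (cong (λ a → 𝟙 (a Fin.≟ i)) (sym atw)) (sym (+-identityˡ _))))

  load-shift-≡ : ∀ u {x e} o′ i → χ i e - 0ℚ - weight (χ i) o′ ≡ 0ℚ →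
                 load (shift u x e nothing o′) i ≡ load x i
  load-shift-≡ u {x} {e} o′ i h = begin
    load (shift u x e nothing o′) i ≡⟨ ⟨,⟩-shift (χ i) u x e nothing o′ ⟩
    load x i + u * (χ i e - 0ℚ - weight (χ i) o′) ≡⟨ cong (λ s → load x i + u * s) h ⟩
    load x i + u * 0ℚ ≡⟨ trans (cong (load x i +_) (*-zeroʳ u)) (+-identityʳ _) ⟩
    load x i ∎
    where open ≡-Reasoning

  load-exchange : ∀ u {x e v} → at S v ≡ at S e → ∀ i → load (shift u x e nothing (just v)) i ≡ load x i
  load-exchange u {x} {e} {v} atv i = load-shift-≡ u (just v) i
    (trans (cong (λ a → χ i e - 0ℚ - 𝟙 (a Fin.≟ i)) atv)
      (trans (cong (_- χ i e) (+-identityʳ (χ i e))) (+-inverseʳ (χ i e))))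

  load-elsewhere : ∀ u {x e i} → at S e ≢ i → load (shift u x e nothing nothing) i ≡ load x i
  load-elsewhere u {x} {e} {i} e∉i = load-shift-≡ u nothing i (cong (λ s → s - 0ℚ - 0ℚ) (𝟙-no (at S e Fin.≟ i) e∉i))

-- Translation of loads and blocking edges to the two sides.

-- The summand in loadJ and loadM is a nameless local function of Defs; unification recovers it.
summand : ∀ {n f} → ∑ n f ≡ ∑ n f → Fin n → ℚ
summand {f = f} _ = f

module _ (I : Instance) where
  open Instance I

  J M : Side nE
  J = record { at = jobOf  ; rank = rankJ ; quota = qJ }
  M = record { at = machOf ; rank = rankM ; quota = qM }

  loadJ≡ : ∀ x j → loadJ I x j ≡ load J x j
  loadJ≡ x j = ∑-cong nE pointwise
    where
    pointwise : ∀ e → summand (refl {x = loadJ I x j}) e ≡ 𝟙 (jobOf e Fin.≟ j) * x e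
    pointwise e with jobOf e Fin.≟ j
    ... | yes _ = sym (*-identityˡ (x e))
    ... | no  _ = sym (*-zeroˡ (x e))

  loadM≡ : ∀ x m → loadM I x m ≡ load M x m
  loadM≡ x m = ∑-cong nE pointwise
    where
    pointwise : ∀ e → summand (refl {x = loadM I x m}) e ≡ 𝟙 (machOf e Fin.≟ m) * x e
    pointwise e with machOf e Fin.≟ m
    ... | yes _ = sym (*-identityˡ (x e))
    ... | no  _ = sym (*-zeroˡ (x e))

  blocking⇒ : ∀ {x e} → Blocking I x e → x e < cap e × Willing J x e × Willing M x e
  blocking⇒ {x} {e} (x<c , j , m) = x<c ,
    Sum.map (subst (_< qJ (jobOf e)) (loadJ≡ x (jobOf e))) (λ (w , (atw , 0<xw , _) , e<w) → w , atw , e<w , 0<xw) j ,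
    Sum.map (subst (_< qM (machOf e)) (loadM≡ x (machOf e))) (λ (w , (atw , 0<xw , _) , e<w) → w , atw , e<w , 0<xw) m

  ⇒blocking : ∀ {x e} → x e < cap e → Willing J x e → Willing M x e → Blocking I x e
  ⇒blocking {x} {e} x<c j m = x<c ,
    Sum.map (subst (_< qJ (jobOf e)) (sym (loadJ≡ x (jobOf e)))) (below⇒worst J) j ,
    Sum.map (subst (_< qM (machOf e)) (sym (loadM≡ x (machOf e)))) (below⇒worst M) m

  Keen : Allocation I → Fin nE → Set
  Keen x e = x e < cap e × ∃ (Below J x e) × Willing M x e

  -- Unit steps as better responses.

  module Process {u : ℚ} (0<u : 0ℚ < u) (u∣cap : ∀ e → u ∣ᵘ cap e)
                 (u∣qJ : ∀ j → u ∣ᵘ qJ j) (u∣qM : ∀ m → u ∣ᵘ qM m) where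

    Valid : Allocation I → Set
    Valid x = Feasible I x × (∀ e → u ∣ᵘ x e)

    module Step {x e o o′} (valid : Valid x) (xe<cap : x e < cap e)
                (relJ : Release J x e o) (relM : Release M x e o′) where

      private
        0≤x = proj₁ (proj₁ valid)
        x≤cap = proj₁ (proj₂ (proj₁ valid))
        loadJ≤q = proj₁ (proj₂ (proj₂ (proj₁ valid)))
        loadM≤q = proj₂ (proj₂ (proj₂ (proj₁ valid)))
        u∣x = proj₂ valid

      y : Allocation I
      y = shift u x e o o′

      open Shift u x e o o′

      y-e : y e ≡ x e + u
      y-e = at-e (release-≢ J o relJ) (release-≢ M o′ relM)

      -- An edge released by both endpoints of e would share both with e.
      disjoint : ∀ {f} → o ≡ just f → o′ ≢ just f
      disjoint {f} refl refl with simple f e (proj₁ relJ) (proj₁ relM)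
      ... | refl = release-≢ J {x} (just f) relJ refl

      released-positive : ∀ {f} → o ≡ just f ⊎ o′ ≡ just f → 0ℚ < x f
      released-positive (inj₁ refl) = proj₂ (proj₂ relJ)
      released-positive (inj₂ refl) = proj₂ (proj₂ relM)

      y≤x : ∀ {f} → f ≢ e → y f ≤ x f
      y≤x {f} f≢e with change f≢e disjoint
      ... | inj₁ y≡x         = ≤-reflexive y≡x
      ... | inj₂ (y≡x-u , _) = subst (_≤ x f) (sym y≡x-u) (p-q≤p (x f) (<⇒≤ 0<u))

      0≤y : ∀ f → 0ℚ ≤ y f
      0≤y f with f Fin.≟ e
      ... | yes refl = subst (0ℚ ≤_) (sym y-e)
        (≤-trans (0≤x f) (subst (_≤ x f + u) (+-identityʳ (x f)) (+-monoʳ-≤ (x f) (<⇒≤ 0<u))))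
      ... | no f≢e with change f≢e disjoint
      ...   | inj₁ y≡x           = subst (0ℚ ≤_) (sym y≡x) (0≤x f)
      -- A released edge is positive, so it holds at least one unit.
      ...   | inj₂ (y≡x-u , rel) = subst (0ℚ ≤_) (sym y≡x-u)
        (0≤q-p (subst (_≤ x f) (+-identityˡ u) (∣ᵘ-gap 0<u ∣ᵘ-0 (u∣x f) (released-positive rel))))

      y≤cap : ∀ f → y f ≤ cap f
      y≤cap f with f Fin.≟ e
      ... | yes refl = subst (_≤ cap f) (sym y-e) (∣ᵘ-gap 0<u (u∣x f) (u∣cap f) xe<cap)
      ... | no f≢e   = ≤-trans (y≤x f≢e) (x≤cap f)

      valid′ : Valid y
      valid′ =
        ( 0≤y
        , y≤cap
        , (λ j → subst (_≤ qJ j) (sym (loadJ≡ y j))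
                   (load-shift-≤ J 0<u u∣x u∣qJ (λ j → subst (_≤ qJ j) (loadJ≡ x j) (loadJ≤q j)) o o′ relJ j))
        , (λ m → subst (_≤ qM m) (sym (trans (loadM≡ y m) (⟨,⟩-shift-comm (χ M m) u x e o o′)))
                   (load-shift-≤ M 0<u u∣x u∣qM (λ m → subst (_≤ qM m) (loadM≡ x m) (loadM≤q m)) o′ o relM m)))
        , ∣ᵘ-move (∣ᵘ-move (∣ᵘ-move u∣x (just e) ∣ᵘ-refl) o (∣ᵘ-neg ∣ᵘ-refl)) o′ (∣ᵘ-neg ∣ᵘ-refl)

      response : BetterResponse I x y
      response =
        e , ⇒blocking xe<cap (release⇒willing J o relJ) (release⇒willing M o′ relM) , xe<ye , others , proj₁ valid′
        where
        xe<ye : x e < y e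
        xe<ye = subst₂ _<_ (+-identityʳ (x e)) (sym y-e) (+-monoʳ-< (x e) 0<u)

        worse : ∀ {f} → o ≡ just f ⊎ o′ ≡ just f →
                (jobOf f ≡ jobOf e × rankJ e ℕ.< rankJ f) ⊎ (machOf f ≡ machOf e × rankM e ℕ.< rankM f)
        worse (inj₁ refl) = inj₁ (proj₁ relJ , proj₁ (proj₂ relJ))
        worse (inj₂ refl) = inj₂ (proj₁ relM , proj₁ (proj₂ relM))

        others : ∀ f → f ≢ e → y f ≡ x f ⊎ (y f < x f × ((jobOf f ≡ jobOf e × rankJ e ℕ.< rankJ f)
                                                          ⊎ (machOf f ≡ machOf e × rankM e ℕ.< rankM f)))
        others f f≢e = Sum.map₂ (λ (y≡x-u , rel) → subst (_< x f) (sym y≡x-u) (p-q<p (x f) 0<u) , worse rel)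
                                (change f≢e disjoint)

    drop-unit : ∀ {p q} → p ≤ q + u * (- 1ℚ) → p + u ≤ q
    drop-unit {p} {q} h = subst (p + u ≤_)
      (solve 2 (λ q u → q :+ u :* (:- con 1ℚ) :+ u := q) refl q u) (+-monoˡ-≤ u h)

    -- First phase: removing keen edges.

    keen? : ∀ x e → Dec (Keen x e)
    keen? x e = (x e <? cap e) ×-dec below? J x e ×-dec willing? M x e

    remove-keen : ∀ {x} → Valid x → ∃ λ y → Steps I x y × Valid y × (∀ e → ¬ Keen y e)
    remove-keen = descend φ 0<u (λ valid → ∑-∣ᵘ nE (λ e → ∣ᵘ-ι* (pos (rankJ e)) (proj₂ valid e))) 0≤φ progress
      where
      W : Fin nE → ℚ
      W e = ι (pos (rankJ e))

      φ : Allocation I → ℚ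
      φ x = ⟨ W , x ⟩

      0≤φ : ∀ {x} → Valid x → 0ℚ ≤ φ x
      0≤φ {x} ((0≤x , _) , _) = subst (_≤ φ x) (∑-0 nE) (∑-mono nE (λ e →
        subst (_≤ W e * x e) (*-zeroʳ (W e)) (*-monoˡ-≤-nonNeg (W e) {{nonNegative (0≤ι (rankJ e))}} (0≤x e))))

      0≤weight : ∀ o → 0ℚ ≤ weight W o
      0≤weight nothing  = ≤-refl
      0≤weight (just f) = 0≤ι (rankJ f)

      progress : ∀ {x} → Valid x →
                 (∀ e → ¬ Keen x e) ⊎ ∃ λ y → BetterResponse I x y × Valid y × φ y + u ≤ φ x
      progress {x} valid with any? (keen? x)
      ... | no ¬keen = inj₁ (λ e keen → ¬keen (e , keen))
      ... | yes (e , x<c , (w , below) , m) with willing⇒release M m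
      -- Exchanging `w` for the better `e` lowers the rank sum by at least `u`; since ranks are
      -- nonnegative, the machine's release cannot raise it again.
      ...   | o′ , relM = inj₂ (S.y , S.response , S.valid′ , drop-unit
                (⟨,⟩-shift-≤ W x e (just w) o′ (- 1ℚ) 0<u (ι-mono-< (ℤ.+<+ (proj₁ (proj₂ below)))) (0≤weight o′)))
        where module S = Step {o = just w} {o′ = o′} valid x<c below relM

    -- Second phase: best responses of jobs with spare quota.

    Settled : Allocation I → Fin nE → Maybe (Fin nE) → Set
    Settled x e nothing  = Spare M x e
    Settled x e (just v) = ¬ Spare M x e × Worst M x (machOf e) v × rankM e ℕ.< rankM v

    settled⇒release : ∀ {x e} o → Settled x e o → Release M x e o
    settled⇒release nothing  spare = spare
    settled⇒release (just v) (_ , (atv , 0<xv , _) , e<v) = atv , e<v , 0<xv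

    -- Spare quota is tested first, so an edge is released only at a saturated machine; choosing the
    -- worst one there ensures that machines only improve.
    settle : ∀ {x e} → Willing M x e → ∃ (Settled x e)
    settle {x} {e} m with load M x (machOf e) <? qM (machOf e)
    settle m            | yes spare = nothing , spare
    settle (inj₁ spare) | no ¬spare = ⊥-elim (¬spare spare)
    settle (inj₂ below) | no ¬spare = let v , worst , e<v = below⇒worst M below in just v , ¬spare , worst , e<v

    blocking? : ∀ x e → Dec (x e < cap e × Willing J x e × Willing M x e)
    blocking? x e = (x e <? cap e) ×-dec willing? J x e ×-dec willing? M x e

    module BestStep {x e o} (valid : Valid x) (¬keen : ∀ f → ¬ Keen x f)
                    (xe<cap : x e < cap e) (spare : Spare J x e) (settled : Settled x e o)
                    (best : ∀ f → jobOf f ≡ jobOf e → x f < cap f → Willing M x f → rankJ e ℕ.≤ rankJ f) where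

      open Step {o = nothing} {o′ = o} valid xe<cap spare (settled⇒release o settled) public
      open Shift u x e nothing o using (unchanged)

      machine-e : Willing M x e
      machine-e = release⇒willing M o (settled⇒release o settled)

      positive-before : ∀ {f} → f ≢ e → 0ℚ < y f → 0ℚ < x f
      positive-before f≢e 0<yf = <-≤-trans 0<yf (y≤x f≢e)

      module _ {f} (off : machOf f ≢ machOf e) where

        load-off : ∀ o → Settled x e o → load M (shift u x e nothing o) (machOf f) ≡ load M x (machOf f)
        load-off nothing  _ = load-elsewhere M u (≢-sym off)
        load-off (just v) (_ , (atv , _) , _) = load-exchange M u atv (machOf f)

        y-off : y f ≡ x f
        y-off = unchanged (λ { refl → off refl }) (λ ()) (kept o settled)
          where
          kept : ∀ o → Settled x e o → o ≢ just f
          kept (just v) (_ , (atv , _) , _) refl = off atv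

        -- Away from the machine of `e`, the load is unchanged and no value rises, so no new
        -- willingness appears.
        willing-off : Willing M y f → Willing M x f
        willing-off (inj₁ s) = inj₁ (subst (_< qM (machOf f)) (load-off o settled) s)
        willing-off (inj₂ (v , atv , f<v , 0<yv)) =
          inj₂ (v , atv , f<v , positive-before (λ { refl → off (sym atv) }) 0<yv)

      -- At e's own machine the edge f keeps its value, since it is not the edge released: after an
      -- exchange the machine has no spare quota and the released edge v was its worst one.
      same-machine : ∀ {f} → machOf f ≡ machOf e → f ≢ e → y f < cap f → Willing M y f →
                     x f < cap f × Willing M x f
      same-machine {f} atf f≢e yf<cap m = go o settled refl m
        where
        stays : o ≢ just f → x f < cap f
        stays o≢f = subst (_< cap f) (unchanged f≢e (λ ()) o≢f) yf<cap

        go : ∀ o₁ → Settled x e o₁ → o ≡ o₁ → Willing M y f → x f < cap f × Willing M x f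
        go nothing s refl _ = stays (λ ()) , inj₁ (subst (λ m → load M x m < qM m) (sym atf) s)
        go (just v) (¬spare , (atv , 0<xv , greatest) , e<v) refl (inj₁ s) =
          ⊥-elim (¬spare (subst (λ m → load M x m < qM m) atf
            (subst (_< qM (machOf f)) (load-exchange M u atv (machOf f)) s)))
        go (just v) (_ , (atv , 0<xv , greatest) , e<v) refl (inj₂ (w , atw , f<w , 0<yw)) =
          stays (λ { refl → ℕₚ.<-irrefl refl f<v }) , inj₂ (v , trans atv (sym atf) , f<v , 0<xv)
          where
          f<v : rankM f ℕ.< rankM v
          -- The witness `w` is either the raised edge `e`, which beats `v`, or was positive before
          -- and ranks no worse than the worst edge `v`.
          f<v with w Fin.≟ e
          ... | yes refl = ℕₚ.<-trans f<w e<v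
          ... | no w≢e   = ℕₚ.<-≤-trans f<w (greatest w (trans atw atf) (positive-before w≢e 0<yw))

      -- Let `w` be the worse edge that makes `f` keen afterwards. At the job of `e`, `w` is `e` or
      -- ranks no worse than `e`, as `e` was not keen before. So the job prefers `f` to `e`; then
      -- `f` lies at another machine, was available before, and contradicts `best`. At another job,
      -- `w` was already positive, so `f` was keen before the step.
      ¬keen′ : ∀ f → ¬ Keen y f
      ¬keen′ f (yf<cap , (w , atw , f<w , 0<yw) , m) with jobOf f Fin.≟ jobOf e
      ... | yes atf = ℕₚ.<⇒≱ f<e (best f atf (subst (_< cap f) (y-off off) yf<cap) (willing-off off m))
        where
        f<e : rankJ f ℕ.< rankJ e
        f<e with w Fin.≟ e
        ... | yes refl = f<w
        ... | no w≢e   = ℕₚ.<-≤-trans f<w (ℕₚ.≮⇒≥ (λ e<w →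
                ¬keen e (xe<cap , (w , trans atw atf , e<w , positive-before w≢e 0<yw) , machine-e)))
        off : machOf f ≢ machOf e
        off same with simple f e atf same
        ... | refl = ℕₚ.<-irrefl refl f<e
      ... | no f∉j = ¬keen f
        (proj₁ before , (w , atw , f<w , positive-before (λ { refl → f∉j (sym atw) }) 0<yw) , proj₂ before)
        where
        before : x f < cap f × Willing M x f
        before with machOf f Fin.≟ machOf e
        ... | yes same = same-machine same (λ { refl → f∉j refl }) yf<cap m
        ... | no off   = subst (_< cap f) (y-off off) yf<cap , willing-off off m

    stabilise : ∀ {x} → Valid x × (∀ e → ¬ Keen x e) →
                ∃ λ y → Steps I x y × (Valid y × (∀ e → ¬ Keen y e)) × (∀ e → ¬ Blocking I y e)
    stabilise = descend φ 0<u u∣φ 0≤φ progress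
      where
      R : ℕ
      R = proj₁ (upper-bound rankM)

      -- Subtracting `suc R` makes every height at most -1, so even a step without a release lowers
      -- the potential by a full unit.
      height : Fin nE → ℤ
      height e = pos (rankM e) ℤ.- pos (suc R)

      height<0 : ∀ e → height e ℤ.< pos 0
      height<0 e = subst (height e ℤ.<_) (ℤₚ.+-inverseʳ (pos (suc R)))
        (ℤₚ.+-monoˡ-< (ℤ.- pos (suc R)) (ℤ.+<+ (ℕ.s≤s (proj₂ (upper-bound rankM) e))))

      W : Fin nE → ℚ
      W e = ι (height e)

      -- All weights are negative and `x ≤ cap`, so the weighted sum is bounded below by its value
      -- at `cap`; subtracting that value gives a nonnegative potential.
      φ : Allocation I → ℚ
      φ x = ⟨ W , x ⟩ - ⟨ W , cap ⟩

      u∣φ : ∀ {x} → Valid x × _ → u ∣ᵘ φ x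
      u∣φ ((_ , u∣x) , _) = ∣ᵘ-+ (∑-∣ᵘ nE (λ e → ∣ᵘ-ι* (height e) (u∣x e)))
                                 (∣ᵘ-neg (∑-∣ᵘ nE (λ e → ∣ᵘ-ι* (height e) (u∣cap e))))

      0≤φ : ∀ {x} → Valid x × _ → 0ℚ ≤ φ x
      0≤φ {x} (((_ , x≤cap , _) , _) , _) = 0≤q-p (∑-mono nE (λ e →
        *-monoˡ-≤-nonPos (W e) {{nonPositive (subst (W e ≤_) ι-0 (ι-mono-≤ (ℤₚ.<⇒≤ (height<0 e))))}} (x≤cap e)))

      lower : ∀ {x e} o → Settled x e o → W e ≤ - 1ℚ + weight W o
      lower {e = e} nothing  _ = subst (λ s → W e ≤ - 1ℚ + s) ι-0 (ι-mono-< (height<0 e))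
      lower (just v) (_ , _ , e<v) = ι-mono-< (ℤₚ.+-monoˡ-< (ℤ.- pos (suc R)) (ℤ.+<+ e<v))

      progress : ∀ {x} → Valid x × (∀ e → ¬ Keen x e) →
                 (∀ e → ¬ Blocking I x e) ⊎
                 ∃ λ y → BetterResponse I x y × (Valid y × (∀ e → ¬ Keen y e)) × φ y + u ≤ φ x
      progress {x} (valid , ¬keen) with any? (blocking? x)
      ... | no ¬blocking = inj₁ (λ e b → ¬blocking (e , blocking⇒ b))
      -- A blocking edge whose job holds a worse edge would be keen.
      ... | yes (e₀ , x<c₀ , inj₂ below , m₀) = ⊥-elim (¬keen e₀ (x<c₀ , below , m₀))
      ... | yes (e₀ , x<c₀ , inj₁ spare , m₀)
        -- Spare quota makes the job willing for each of its edges, so the candidates are exactly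
        -- its blocking edges.
        with minimal (λ f → (jobOf f Fin.≟ jobOf e₀) ×-dec (x f <? cap f) ×-dec willing? M x f) rankJ
                     (e₀ , refl , x<c₀ , m₀)
      ... | e , (ate , x<c , m) , least with settle m
      ... | o , settled = inj₂ (S.y , S.response , (S.valid′ , S.¬keen′) , drop-unit (begin
          ⟨ W , S.y ⟩ - ⟨ W , cap ⟩
            ≡⟨ cong (_- ⟨ W , cap ⟩) (⟨,⟩-shift-comm W u x e nothing o) ⟩
          ⟨ W , shift u x e o nothing ⟩ - ⟨ W , cap ⟩
            ≤⟨ +-monoˡ-≤ (- ⟨ W , cap ⟩) (⟨,⟩-shift-≤ W x e o nothing (- 1ℚ) 0<u (lower o settled) ≤-refl) ⟩
          ⟨ W , x ⟩ + u * (- 1ℚ) - ⟨ W , cap ⟩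
            ≡⟨ solve 3 (λ p q r → p :+ q :- r := p :- r :+ q) refl ⟨ W , x ⟩ (u * (- 1ℚ)) ⟨ W , cap ⟩ ⟩
          φ x + u * (- 1ℚ) ∎))
        where
        open ≤-Reasoning
        module S = BestStep {o = o} valid ¬keen x<c (subst (λ j → load J x j < qJ j) (sym ate) spare) settled
                     (λ f atf x<c′ m′ → least f (trans atf ate , x<c′ , m′))

-- Choice of the unit and composition of the two phases.

theorem2 : (I : Instance) (x : Allocation I) → Feasible I x →
    ∃ λ y → Steps I x y × Stable I y
theorem2 I x feasible =
  -- The unit starts at 1 and is refined for `x`, the capacities and both families of quotas in
  -- turn. Each new unit divides the previous one, so earlier divisibilities persist.
  let u₁ , 0<u₁ , _     , u₁∣x   = refine-unit x 1ℚ (positive⁻¹ 1ℚ)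
      u₂ , 0<u₂ , u₂∣u₁ , u₂∣cap = refine-unit cap u₁ 0<u₁
      u₃ , 0<u₃ , u₃∣u₂ , u₃∣qJ  = refine-unit qJ u₂ 0<u₂
      u  , 0<u  , u∣u₃  , u∣qM   = refine-unit qM u₃ 0<u₃
      u∣u₂ = ∣ᵘ-trans u∣u₃ u₃∣u₂
      open Process I 0<u (λ e → ∣ᵘ-trans u∣u₂ (u₂∣cap e)) (λ j → ∣ᵘ-trans u∣u₃ (u₃∣qJ j)) u∣qM
      y , x⟶*y , valid-y , ¬keen = remove-keen (feasible , λ e → ∣ᵘ-trans (∣ᵘ-trans u∣u₂ u₂∣u₁) (u₁∣x e))
      z , y⟶*z , (valid-z , _) , ¬blocking = stabilise (valid-y , ¬keen)
  in z , x⟶*y ◅◅ y⟶*z , proj₁ valid-z , ¬blocking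
  where open Instance I
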